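{- Let $k>2$ be a natural number. The $k$-element cycle $C_k$ is point-by-point retractable if and only if $k<5$. It is sociable if and only if $k=3$.
   Context: A graph is a pair $(V,E)$ where $E$ is a symmetric and reflexive binary relation on $V$ (every vertex has a loop; in particular all vertices of $C_k$ carry loops). A homomorphism is an edge-preserving map (it may collapse edges). A retraction of $X$ onto $Y\subseteq X$ is a homomorphism $X\to Y$ (with $Y$ the induced subgraph) that is the identity on $Y$; then $Y$ is a retract of $X$. A graph $X$ is point-by-point retractable (PPR) if $X=\bigcup_{n\in\omega}X_n$ where the $X_n$ are induced subgraphs, $|X_0|=1$, $X_n\subseteq X_{n+1}$, $|X_{n+1}\setminus X_n|\leq 1$, and $X_n$ is a retract of $X_{n+1}$ for each $n\in\omega$. A graph $X$ is sociable if $X=\bigcup_{n\in\omega}X_n$ where the $X_n$ are induced subgraphs, $|X_0|=1$, $X_n\subseteq X_{n+1}$, $|X_{n+1}\setminus X_n|\leq 1$, and for each $n$ there is a retraction $p_n$ of $X_{n+1}$ onto $X_n$ such that, if $X_{n+1}\setminus X_n=\{w\}$, then $w$ is adjacent to $p_n(w)$. -}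

module Defs where

open import Data.Fin using (Fin; toℕ)
open import Data.Nat using (ℕ; zero; suc)
open import Data.Product using (∃-syntax; Σ-syntax)
open import Data.Refinement using (Refinement; value; refine)
open import Data.Sum using (_⊎_; inj₁; inj₂)
open import Level using (0ℓ)
open import Relation.Binary using (Rel; Reflexive; Symmetric; _Preserves_⟶_)
open import Relation.Binary.PropositionalEquality using (_≡_; refl; sym)
open import Relation.Unary using (Pred; _∈_; _⊆_; _≐_; _∖_; ｛_｝; Universal; ⋃)

record Graph : Set₁ where
  field
    Vertex : Set
    _~_    : Rel Vertex 0ℓ
    ~-refl : Reflexive _~_
    ~-sym  : Symmetric _~_

open Graph using (Vertex)

record Hom (G H : Graph) : Set where
  private
    module G = Graph G
    module H = Graph H
  field
    to        : Vertex G → Vertex H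
    preserves : to Preserves G._~_ ⟶ H._~_

open Hom public using (to)

-- The membership proof carried by a vertex is irrelevant (Data.Refinement),
-- so equality of vertices of the induced subgraph is equality in G.
Induced : (G : Graph) → Pred (Vertex G) 0ℓ → Graph
Induced G P = record
  { Vertex = Refinement (Vertex G) P
  ; _~_    = λ x y → value x G.~ value y
  ; ~-refl = G.~-refl
  ; ~-sym  = G.~-sym
  }
  where module G = Graph G

record Retraction (G : Graph) (P Q : Pred (Vertex G) 0ℓ) (Q⊆P : Q ⊆ P) : Set where
  field
    hom   : Hom (Induced G P) (Induced G Q)
    fixes : ∀ y → to hom (refine Q⊆P y) ≡ y

open Retraction public using (hom)

record Filtration (G : Graph) : Set₁ where
  field
    X         : ℕ → Pred (Vertex G) 0ℓ
    singleton : ∃[ v ] X zero ≐ ｛ v ｝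
    increases : ∀ n → X n ⊆ X (suc n)
    adds≤1    : ∀ n {v w} → v ∈ X (suc n) ∖ X n → w ∈ X (suc n) ∖ X n → v ≡ w
    covers    : Universal (⋃ ℕ X)

PPR : Graph → Set₁
PPR G = Σ[ F ∈ Filtration G ] let open Filtration F in
  ∀ n → Retraction G (X (suc n)) (X n) (increases n)

Sociable : Graph → Set₁
Sociable G = Σ[ F ∈ Filtration G ] let open Filtration F in
  ∀ n → Σ[ p ∈ Retraction G (X (suc n)) (X n) (increases n) ]
    (∀ w → X (suc n) ∖ X n ≐ ｛ value w ｝ → value w ~ value (to (hom p) w))
  where open Graph G using (_~_)

-- Cyclic successor on 0, …, k - 1.
data Next {k : ℕ} (i j : Fin k) : Set where
  step : toℕ j ≡ suc (toℕ i) → Next i j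
  wrap : suc (toℕ i) ≡ k → toℕ j ≡ 0 → Next i j

Cycle : ℕ → Graph
Cycle k = record
  { Vertex = Fin k
  ; _~_    = λ i j → i ≡ j ⊎ Next i j ⊎ Next j i
  ; ~-refl = inj₁ refl
  ; ~-sym  = λ where
      (inj₁ i≡j)        → inj₁ (sym i≡j)
      (inj₂ (inj₁ i→j)) → inj₂ (inj₂ i→j)
      (inj₂ (inj₂ j→i)) → inj₂ (inj₁ j→i)
  }

-- When C_k is exhausted by successive retracts, the last step is a retraction
-- of C_k onto C_k ∖ {w}. It sends w to some u ≢ w adjacent to both neighbours
-- of w, which closes up a walk of length at most 4; since k divides the length
-- of every closed walk, k ≤ 4. If moreover u is adjacent to w, then u is one of
-- the neighbours of w, and the walk has length at most 3.
{-# OPTIONS --safe #-}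
module Submission where

open import Defs
open import Data.Fin using (Fin; toℕ; zero; suc; fromℕ<)
open import Data.Fin.Properties
  using (sequence; ¬∀⟶∃¬; toℕ-injective; toℕ<n; toℕ-fromℕ<)
open import Data.Irrelevant using ([_])
open import Data.List using (tabulate)
open import Data.List.Extrema.Nat using (max; xs≤max)
open import Data.List.Relation.Unary.All.Properties using (tabulate⁻)
open import Data.Nat using (ℕ; zero; suc; _+_; _*_; _≤_; _<_; _≤?_; z≤n; s≤s; _≤′_; ≤′-refl; ≤′-step)
open import Data.Nat.Divisibility using (_∣_; divides; ∣⇒≤)
open import Data.Nat.Properties
open import Data.Product using (_×_; _,_; ∃-syntax; proj₁; proj₂; map₂)
open import Data.Refinement using (Refinement; value; _,_)
open import Data.Sum using (inj₁; inj₂)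
open import Effect.Monad using (RawMonad)
open import Function using (_∘_)
open import Function.Bundles using (_⇔_; mk⇔)
open import Relation.Binary.PropositionalEquality
  using (_≡_; _≢_; refl; sym; trans; cong; subst; module ≡-Reasoning)
open import Relation.Nullary using (¬_; yes; no; contradiction)
open import Relation.Nullary.Decidable using (decidable-stable; ¬¬-excluded-middle)
open import Relation.Nullary.Negation using (¬¬-Monad; contradiction-irr)
open import Relation.Unary using (Universal; Decidable; _∈_; _∉_)

private
  variable
    k n : ℕ

-- Closed walks in the cycle

next-functional : {i j j′ : Fin k} → Next i j → Next i j′ → j ≡ j′
next-functional (step p) (step q) = toℕ-injective (trans p (sym q))
next-functional {j = j} (step p) (wrap q _) = contradiction (trans p q) (<⇒≢ (toℕ<n j))
next-functional {j′ = j} (wrap p _) (step q) = contradiction (trans q p) (<⇒≢ (toℕ<n j))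
next-functional (wrap _ p) (wrap _ q) = toℕ-injective (trans p (sym q))

next-injective : {i i′ j : Fin k} → Next i j → Next i′ j → i ≡ i′
next-injective (step p) (step q) = toℕ-injective (suc-injective (trans (sym p) q))
next-injective (step p) (wrap _ q) = contradiction (trans (sym p) q) λ ()
next-injective (wrap _ p) (step q) = contradiction (trans (sym q) p) λ ()
next-injective (wrap p _) (wrap q _) = toℕ-injective (suc-injective (trans p (sym q)))

successor : (i : Fin k) → ∃[ j ] Next i j
successor {k = suc k} i with toℕ i ≟ k
... | yes i≡k = zero , wrap (cong suc i≡k) refl
... | no i≢k = fromℕ< i+1<k , step (toℕ-fromℕ< i+1<k)
  where i+1<k = s≤s (≤∧≢⇒< (≤-pred (toℕ<n i)) i≢k)

predecessor : (j : Fin k) → ∃[ i ] Next i j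
predecessor {k = suc k} j with toℕ j in j≡
... | zero = fromℕ< (n<1+n k) , wrap (cong suc (toℕ-fromℕ< (n<1+n k))) j≡
... | suc i = fromℕ< i<k , step (trans j≡ (cong suc (sym (toℕ-fromℕ< i<k))))
  where i<k = <-trans (n<1+n i) (subst (_< suc k) j≡ (toℕ<n j))

infixr 5 _∷_

data Walk {k : ℕ} : ℕ → Fin k → Fin k → Set where
  []  : ∀ {i} → Walk 0 i i
  _∷_ : ∀ {n i j l} → Next i j → Walk n j l → Walk (suc n) i l

-- Each `step` raises the position by one and each `wrap` raises it by one and then drops it by `k`;
-- `e` counts the wraps.
winding : {i j : Fin k} → Walk n i j → ∃[ e ] n + toℕ i ≡ e * k + toℕ j
winding [] = 0 , refl
winding {k = k} {i = i} {l} (_∷_ {n} {j = j} next walk) with winding walk | next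
... | e , eq | step p = e , (begin
  suc n + toℕ i     ≡⟨ sym (+-suc n (toℕ i)) ⟩
  n + suc (toℕ i)   ≡⟨ cong (n +_) (sym p) ⟩
  n + toℕ j         ≡⟨ eq ⟩
  e * k + toℕ l     ∎)
  where open ≡-Reasoning
... | e , eq | wrap p q = suc e , (begin
  suc n + toℕ i       ≡⟨ sym (+-suc n (toℕ i)) ⟩
  n + suc (toℕ i)     ≡⟨ cong (n +_) p ⟩
  n + k               ≡⟨ +-comm n k ⟩
  k + n               ≡⟨ cong (k +_) (sym (+-identityʳ n)) ⟩
  k + (n + 0)         ≡⟨ cong (λ x → k + (n + x)) (sym q) ⟩
  k + (n + toℕ j)     ≡⟨ cong (k +_) eq ⟩
  k + (e * k + toℕ l) ≡⟨ sym (+-assoc k (e * k) (toℕ l)) ⟩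
  suc e * k + toℕ l   ∎)
  where open ≡-Reasoning

closed-walk : {i : Fin k} → Walk (suc n) i i → k ∣ suc n
closed-walk {i = i} walk with winding walk
... | e , eq = divides e (+-cancelʳ-≡ (toℕ i) _ _ eq)

closed-walk-length : {i : Fin k} → Walk (suc n) i i → k ≤ suc n
closed-walk-length walk = ∣⇒≤ (closed-walk walk)

-- Neighbours of a dominated vertex

module _ {k : ℕ} where
  open Graph (Cycle k)

  -- A step from `b` to `u` or from `u` to `a` would force `u ≡ w`. In the other cases the walk from
  -- `b` through `w` to `a` continues forward through `u` to `b`, where either of the last two steps
  -- may collapse to an equality.
  common-neighbours : {a b w u : Fin k} → Next b w → Next w a →
    u ≢ w → b ~ u → a ~ u → k ≤ 4
  common-neighbours b→w w→a u≢w (inj₁ refl) (inj₁ refl) =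
    ≤-trans (closed-walk-length (b→w ∷ w→a ∷ [])) (s≤s (s≤s z≤n))
  common-neighbours b→w w→a u≢w (inj₁ refl) (inj₂ (inj₁ a→b)) =
    ≤-trans (closed-walk-length (b→w ∷ w→a ∷ a→b ∷ [])) (n≤1+n 3)
  common-neighbours b→w w→a u≢w (inj₁ refl) (inj₂ (inj₂ b→a)) =
    contradiction (next-injective b→a w→a) u≢w
  common-neighbours b→w w→a u≢w (inj₂ (inj₁ b→u)) _ =
    contradiction (next-functional b→u b→w) u≢w
  common-neighbours b→w w→a u≢w (inj₂ (inj₂ u→b)) (inj₁ refl) =
    ≤-trans (closed-walk-length (u→b ∷ b→w ∷ w→a ∷ [])) (n≤1+n 3)
  common-neighbours b→w w→a u≢w (inj₂ (inj₂ u→b)) (inj₂ (inj₁ a→u)) =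
    closed-walk-length (u→b ∷ b→w ∷ w→a ∷ a→u ∷ [])
  common-neighbours b→w w→a u≢w (inj₂ (inj₂ u→b)) (inj₂ (inj₂ u→a)) =
    contradiction (next-injective u→a w→a) u≢w

  adjacent-neighbours : {a b w : Fin k} → Next b w → Next w a → a ~ b → k ≤ 3
  adjacent-neighbours b→w w→a (inj₁ refl) =
    ≤-trans (closed-walk-length (b→w ∷ w→a ∷ [])) (n≤1+n 2)
  adjacent-neighbours b→w w→a (inj₂ (inj₁ a→b)) = closed-walk-length (b→w ∷ w→a ∷ a→b ∷ [])
  -- Here `a` coincides with `w`, so `w→a` is a closed walk of length 1.
  adjacent-neighbours b→w w→a (inj₂ (inj₂ b→a)) with refl ← next-functional b→a b→w =
    ≤-trans (closed-walk-length (w→a ∷ [])) (s≤s z≤n)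

  -- The restriction `v ≢ w` matters: with `v = w` allowed, the loop at `w` would yield `w ~ u`,
  -- which a retraction need not provide. That adjacency is exactly what sociability adds.
  record Dominates (u w : Fin k) : Set where
    field
      distinct   : u ≢ w
      neighbours : ∀ {v} → v ≢ w → v ~ w → v ~ u

  module _ {u w : Fin k} (1<k : 1 < k) (u-dom-w : Dominates u w) where
    open Dominates u-dom-w

    private
      a b : Fin k
      a = proj₁ (successor w)
      b = proj₁ (predecessor w)

      w→a : Next w a
      w→a = proj₂ (successor w)

      b→w : Next b w
      b→w = proj₂ (predecessor w)

      loopless : {i : Fin k} → ¬ Next i i
      loopless i→i = <⇒≱ 1<k (closed-walk-length (i→i ∷ []))

      a~u : a ~ u
      a~u = neighbours (λ a≡w → loopless (subst (Next w) a≡w w→a)) (inj₂ (inj₂ w→a))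

      b~u : b ~ u
      b~u = neighbours (λ b≡w → loopless (subst (λ x → Next x w) b≡w b→w)) (inj₂ (inj₁ b→w))

    dominated⇒k≤4 : k ≤ 4
    dominated⇒k≤4 = common-neighbours b→w w→a distinct b~u a~u

    -- A vertex adjacent to `w` and distinct from it is `a` or `b`, so domination makes `a` and `b`
    -- adjacent to each other.
    adjacent-dominated⇒k≤3 : w ~ u → k ≤ 3
    adjacent-dominated⇒k≤3 (inj₁ w≡u) = contradiction (sym w≡u) distinct
    adjacent-dominated⇒k≤3 (inj₂ (inj₁ w→u)) with refl ← next-functional w→u w→a =
      adjacent-neighbours b→w w→a (~-sym b~u)
    adjacent-dominated⇒k≤3 (inj₂ (inj₂ u→w)) with refl ← next-injective u→w b→w =
      adjacent-neighbours b→w w→a a~u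

-- The last step of a filtration

value-≢ : {A : Set} {P : A → Set} {w : A} (v : Refinement A P) → ¬ P w → value v ≢ w
value-≢ (_ , [ Pv ]) ¬Pw refl = contradiction-irr Pv ¬Pw

module _ (F : Filtration (Cycle k)) where
  open Filtration F

  X-mono : ∀ {m n v} → m ≤′ n → v ∈ X m → v ∈ X n
  X-mono ≤′-refl v∈ = v∈
  X-mono (≤′-step m≤n) v∈ = increases _ (X-mono m≤n v∈)

  -- There are finitely many vertices, so the largest of the stages at which they are covered
  -- contains them all.
  exhausted : ∃[ n ] Universal (X n)
  exhausted = max 0 (tabulate stage) , λ v →
    X-mono (≤⇒≤′ (tabulate⁻ (xs≤max 0 (tabulate stage)) v)) (proj₂ (covers v))
    where
    stage : Fin k → ℕ
    stage v = proj₁ (covers v)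

  not-full-initially : 1 < k → ¬ Universal (X 0)
  not-full-initially (s≤s (s≤s _)) full with proj₂ singleton
  ... | X₀⊆ , _ with () ← trans (sym (X₀⊆ (full zero))) (X₀⊆ (full (suc zero)))

  record LastStep : Set where
    field
      {stage}  : ℕ
      {vertex} : Fin k
      full     : Universal (X (suc stage))
      missing  : vertex ∉ X stage
      others   : ∀ {v} → v ≢ vertex → v ∈ X stage

  private
    -- Double negation commutes with a conjunction over the finite set `Fin k`, so excluded middle
    -- may be assumed at all vertices at once.
    ¬¬-decidable : ∀ n → ¬ ¬ Decidable (X n)
    ¬¬-decidable n = sequence (RawMonad.rawApplicative ¬¬-Monad) (λ _ → ¬¬-excluded-middle)

  -- Membership in the stages need not be decidable, so the step is only
  -- obtained up to double negation.
  ¬¬-last-step : 1 < k → ¬ ¬ LastStep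
  ¬¬-last-step 1<k none = never-full (proj₁ exhausted) (proj₂ exhausted)
    where
    -- By induction: a full stage right after one that is not full would give a last step, against
    -- `none`.
    never-full : ∀ n → ¬ Universal (X n)
    never-full zero = not-full-initially 1<k
    never-full (suc n) full = ¬¬-decidable n λ X? →
      let w , w∉ = ¬∀⟶∃¬ k (X n) X? (never-full n) in
      none record
        { full    = full
        ; missing = w∉
        ; others  = λ {v} v≢w → decidable-stable (X? v) λ v∉ →
            v≢w (adds≤1 n (full v , v∉) (full w , w∉))
        }

  module _ (s : LastStep) where
    open LastStep s

    last-vertex : Refinement (Fin k) (X (suc stage))
    last-vertex = vertex , [ full vertex ]

    -- A neighbour of `vertex` other than `vertex` lies in `X stage`, so `p` fixes it and carries
    -- its edge to `vertex` to an edge to the image of `vertex`.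
    retraction-dominates :
      (p : Retraction (Cycle k) (X (suc stage)) (X stage) (increases stage)) →
      Dominates (value (to (hom p) last-vertex)) vertex
    retraction-dominates p = record
      { distinct   = value-≢ (to (hom p) last-vertex) missing
      ; neighbours = λ {v} v≢w v~w →
          subst (_~ value (to (hom p) last-vertex))
            (cong value (Retraction.fixes p (v , [ others v≢w ])))
            (Hom.preserves (hom p) v~w)
      }
      where open Graph (Cycle k)

-- Upper bounds on the length of the cycle

PPR⇒k≤4 : 1 < k → PPR (Cycle k) → k ≤ 4
-- The bound is decidable, hence stable, so a last step known only up to double negation suffices.
PPR⇒k≤4 1<k (F , p) = decidable-stable (_ ≤? _) λ k≰4 → ¬¬-last-step F 1<k λ s →
  k≰4 (dominated⇒k≤4 1<k (retraction-dominates F s (p _)))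

Sociable⇒k≤3 : 1 < k → Sociable (Cycle k) → k ≤ 3
Sociable⇒k≤3 {k} 1<k (F , p) = decidable-stable (_ ≤? _) λ k≰3 → ¬¬-last-step F 1<k λ s →
  let open LastStep s
      r , w~r = p stage
      -- Sociability grants the adjacency only once `vertex` is shown to be the whole difference of
      -- the two stages.
      removed = (λ {v} (v∈ , v∉) → adds≤1 stage (full vertex , missing) (v∈ , v∉))
              , λ { refl → full vertex , missing }
  in k≰3 (adjacent-dominated⇒k≤3 1<k (retraction-dominates F s r) (w~r (last-vertex F s) removed))
  where open Filtration F

-- Small cycles

module _ (k : ℕ) where
  open Graph (Cycle (suc k))

  initial-segments : Filtration (Cycle (suc k))
  initial-segments = record
    { X         = λ n v → toℕ v ≤ n
    ; singleton = zero
                , (λ v≤0 → toℕ-injective (sym (n≤0⇒n≡0 v≤0)))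
                , λ { refl → z≤n }
    ; increases = λ _ → m≤n⇒m≤1+n
    ; adds≤1    = λ _ v-new w-new → toℕ-injective (trans (new v-new) (sym (new w-new)))
    ; covers    = λ v → toℕ v , ≤-refl
    }
    where
    new : ∀ {m n} → m ≤ suc n × ¬ m ≤ n → m ≡ suc n
    new (m≤ , m≰) = ≤-antisym m≤ (≰⇒> m≰)

  open Filtration initial-segments

  -- All vertices beyond `n` are sent to `u`. Only edges that leave the segment need `absorbs`; an
  -- edge between two vertices beyond `n` collapses to the loop at `u`.
  fold-onto : ∀ {n u} → toℕ u ≤ n →
    (∀ {v w} → toℕ v ≤ n → n < toℕ w → v ~ w → v ~ u) →
    Retraction (Cycle (suc k)) (X (suc n)) (X n) (increases n)
  fold-onto {n} {u} u≤n absorbs = record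
    { hom   = record { to = fold ∘ value ; preserves = fold-preserves _ _ }
    ; fixes = fold-fixes
    }
    where
    fold : Fin (suc k) → Refinement (Fin (suc k)) (X n)
    fold v with toℕ v ≤? n
    ... | yes v≤n = v , [ v≤n ]
    ... | no _ = u , [ u≤n ]

    fold-preserves : ∀ v w → v ~ w → value (fold v) ~ value (fold w)
    fold-preserves v w v~w with toℕ v ≤? n | toℕ w ≤? n
    ... | yes _ | yes _ = v~w
    ... | yes v≤n | no w≰n = absorbs v≤n (≰⇒> w≰n) v~w
    ... | no v≰n | yes w≤n = ~-sym (absorbs w≤n (≰⇒> v≰n) (~-sym v~w))
    ... | no _ | no _ = ~-refl

    fold-fixes : ∀ (v : Refinement (Fin (suc k)) (X n)) → fold (value v) ≡ v
    fold-fixes (v , [ v≤n ]) with toℕ v ≤? n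
    ... | yes _ = refl
    ... | no v≰n = contradiction-irr v≤n v≰n

triangle : (u v : Fin 3) → Graph._~_ (Cycle 3) u v
triangle zero zero = inj₁ refl
triangle zero (suc zero) = inj₂ (inj₁ (step refl))
triangle zero (suc (suc zero)) = inj₂ (inj₂ (wrap refl refl))
triangle (suc zero) zero = inj₂ (inj₂ (step refl))
triangle (suc zero) (suc zero) = inj₁ refl
triangle (suc zero) (suc (suc zero)) = inj₂ (inj₁ (step refl))
triangle (suc (suc zero)) zero = inj₂ (inj₁ (wrap refl refl))
triangle (suc (suc zero)) (suc zero) = inj₂ (inj₂ (step refl))
triangle (suc (suc zero)) (suc (suc zero)) = inj₁ refl

Sociable-C₃ : Sociable (Cycle 3)
Sociable-C₃ = initial-segments 2 , λ n →
  fold-onto 2 {u = zero} z≤n (λ {v} _ _ _ → triangle v zero) , λ _ _ → triangle _ _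

star-of-1 : (v : Fin 4) → toℕ v ≤ 2 → Graph._~_ (Cycle 4) v (suc zero)
star-of-1 zero _ = inj₂ (inj₁ (step refl))
star-of-1 (suc zero) _ = inj₁ refl
star-of-1 (suc (suc zero)) _ = inj₂ (inj₂ (step refl))
star-of-1 (suc (suc (suc zero))) (s≤s (s≤s ()))

PPR-C₄ : PPR (Cycle 4)
PPR-C₄ = initial-segments 3 , λ where
  -- Vertex 1 is not yet present in stage 0, so the first fold must go to 0.
  zero → fold-onto 3 {u = zero} z≤n λ { {v = zero} _ _ _ → inj₁ refl }
  -- From here on 1 is a target: a vertex `w` beyond `n` has position at most 3, so `v` is one of 0,
  -- 1, 2, all adjacent to 1.
  (suc _) → fold-onto 3 {u = suc zero} (s≤s z≤n) λ {v} {w} v≤n n<w _ →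
    star-of-1 v (≤-pred (≤-trans (s≤s v≤n) (≤-trans n<w (≤-pred (toℕ<n w)))))

Sociable⇒PPR : {G : Graph} → Sociable G → PPR G
Sociable⇒PPR = map₂ λ p n → proj₁ (p n)

proposition6p4 : (k : ℕ) → 2 < k → (PPR (Cycle k) ⇔ k < 5) × (Sociable (Cycle k) ⇔ k ≡ 3)
proposition6p4 k 2<k =
    mk⇔ (s≤s ∘ PPR⇒k≤4 1<k) (small 2<k)
  , mk⇔ (λ S → ≤-antisym (Sociable⇒k≤3 1<k S) 2<k) λ { refl → Sociable-C₃ }
  where
  1<k : 1 < k
  1<k = <-trans (n<1+n 1) 2<k

  small : ∀ {k} → 2 < k → k < 5 → PPR (Cycle k)
  small {3} _ _ = Sociable⇒PPR Sociable-C₃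
  small {4} _ _ = PPR-C₄
  small {1} (s≤s ()) _
  small {2} (s≤s (s≤s ())) _
  small {suc (suc (suc (suc (suc _))))} _ (s≤s (s≤s (s≤s (s≤s (s≤s ())))))
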